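{- Let $\tau \geq 1$ be a real number, and let $\mathcal{S}$ be a finite set of integers of the form $\lfloor \tau k \rfloor$ with $k \in \mathbb{N}$. Let $x < y$ be integers, and suppose that every integer $z$ with $x \le z \le y$ belongs to $\mathcal{S}$. Then $\tau < 1 + \dfrac{1}{y-x}$.
   Context: $\mathbb{N} = \{0,1,2,\dots\}$. The set $\mathcal{S}$ represents the set of distinct values observed in a finite sample of $X = \lfloor \tau N \rfloor$, with $N$ an $\mathbb{N}$-valued random variable. -}

module Defs where

open import Data.Integer as ℤ using (ℤ; +_)
open import Data.Integer.Properties as ℤₚ using ()
open import Data.Nat as ℕ using (ℕ)
open import Data.Nat.Properties as ℕₚ using ()
open import Data.Product using (∃-syntax; _×_; _,_)
open import Data.Rational
open import Data.Rational.Literals using (fromℤ)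
open import Data.Rational.Properties
open import Data.Rational.Solver using (module +-*-Solver)
open import Relation.Binary.PropositionalEquality
  using (_≡_; refl; sym; trans; cong; subst)

------------------------------------------------------------------------
-- Real numbers as Cauchy sequences of rationals with a modulus of
-- convergence.  Two sequences represent the same real when each is _≤ℝ_
-- the other; _≤ℝ_, _<ℝ_ and _*ℝ_ respect that equivalence.

EventuallyWithin : (ℕ → ℚ) → ℚ → Set
EventuallyWithin s ε = ∃[ N ] (∀ m n → N ℕ.≤ m → N ℕ.≤ n → ∣ s m - s n ∣ < ε)

IsCauchy : (ℕ → ℚ) → Set
IsCauchy s = ∀ ε → 0ℚ < ε → EventuallyWithin s ε

record ℝ : Set where
  constructor mkℝ
  field
    seq      : ℕ → ℚ
    isCauchy : IsCauchy seq

open ℝ public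

infix 4 _<ℝ_ _≤ℝ_

_<ℝ_ : ℝ → ℝ → Set
a <ℝ b = ∃[ ε ] (0ℚ < ε × ∃[ N ] (∀ n → N ℕ.≤ n → seq a n + ε ≤ seq b n))

_≤ℝ_ : ℝ → ℝ → Set
a ≤ℝ b = ∀ ε → 0ℚ < ε → ∃[ N ] (∀ n → N ℕ.≤ n → seq a n ≤ seq b n + ε)

ℚ→ℝ : ℚ → ℝ
ℚ→ℝ q = mkℝ (λ _ → q) λ ε 0<ε → 0 , λ _ _ _ _ →
  subst (λ r → ∣ r ∣ < ε) (sym (+-inverseʳ q)) 0<ε

ℤ→ℝ : ℤ → ℝ
ℤ→ℝ z = ℚ→ℝ (fromℤ z)

ℕ→ℝ : ℕ → ℝ
ℕ→ℝ n = ℤ→ℝ (+ n)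

private
  open +-*-Solver

  split : ∀ p q → p ≡ q + (p - q)
  split = solve 2 (λ p q → p := q :+ (p :- q)) refl

  product-difference : ∀ p q r t → p * q - r * t ≡ p * (q - t) + t * (p - r)
  product-difference =
    solve 4 (λ p q r t → p :* q :- r :* t := p :* (q :- t) :+ t :* (p :- r)) refl

  EventuallyBounded : (ℕ → ℚ) → ℚ → Set
  EventuallyBounded s B = ∃[ N ] (∀ n → N ℕ.≤ n → ∣ s n ∣ ≤ B)

  eventually-bounded : ∀ {s} → IsCauchy s →
    ∃[ B ] (0ℚ < B × EventuallyBounded s B)
  eventually-bounded {s} c with c 1ℚ (positive⁻¹ 1ℚ)
  ... | N , close = ∣ s N ∣ + 1ℚ , positive⁻¹ (∣ s N ∣ + 1ℚ) {{sum-pos}} , N , bound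
    where
    open ≤-Reasoning
    sum-pos : Positive (∣ s N ∣ + 1ℚ)
    sum-pos = nonNeg+pos⇒pos ∣ s N ∣ {{nonNegative (0≤∣p∣ (s N))}} 1ℚ

    bound : ∀ n → N ℕ.≤ n → ∣ s n ∣ ≤ ∣ s N ∣ + 1ℚ
    bound n N≤n = begin
      ∣ s n ∣                  ≡⟨ cong ∣_∣ (split (s n) (s N)) ⟩
      ∣ s N + (s n - s N) ∣    ≤⟨ ∣p+q∣≤∣p∣+∣q∣ (s N) (s n - s N) ⟩
      ∣ s N ∣ + ∣ s n - s N ∣  ≤⟨ +-monoʳ-≤ ∣ s N ∣ (<⇒≤ (close n N N≤n ℕₚ.≤-refl)) ⟩
      ∣ s N ∣ + 1ℚ             ∎

  ∣*∣-bound : ∀ p q D δ → 0ℚ < D → ∣ p ∣ ≤ D → ∣ q ∣ < δ → ∣ p * q ∣ < D * δ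
  ∣*∣-bound p q D δ 0<D p≤D q<δ = begin-strict
    ∣ p * q ∣      ≡⟨ ∣p*q∣≡∣p∣*∣q∣ p q ⟩
    ∣ p ∣ * ∣ q ∣  ≤⟨ *-monoʳ-≤-nonNeg ∣ q ∣ {{nonNegative (0≤∣p∣ q)}} p≤D ⟩
    D * ∣ q ∣      <⟨ *-monoʳ-<-pos D {{positive 0<D}} q<δ ⟩
    D * δ          ∎
    where open ≤-Reasoning

  product-close : ∀ p q r t B C δ → 0ℚ < B → 0ℚ < C →
    ∣ p ∣ ≤ B → ∣ t ∣ ≤ C → ∣ p - r ∣ < δ → ∣ q - t ∣ < δ →
    ∣ p * q - r * t ∣ < (B + C) * δ
  product-close p q r t B C δ 0<B 0<C p≤B t≤C pr<δ qt<δ = begin-strict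
    ∣ p * q - r * t ∣                  ≡⟨ cong ∣_∣ (product-difference p q r t) ⟩
    ∣ p * (q - t) + t * (p - r) ∣      ≤⟨ ∣p+q∣≤∣p∣+∣q∣ (p * (q - t)) (t * (p - r)) ⟩
    ∣ p * (q - t) ∣ + ∣ t * (p - r) ∣  <⟨ +-mono-< {∣ p * (q - t) ∣} {B * δ} {∣ t * (p - r) ∣} {C * δ}
                                            (∣*∣-bound p (q - t) B δ 0<B p≤B qt<δ)
                                            (∣*∣-bound t (p - r) C δ 0<C t≤C pr<δ) ⟩
    B * δ + C * δ                      ≡⟨ sym (*-distribʳ-+ δ B C) ⟩
    (B + C) * δ                        ∎
    where open ≤-Reasoning

  divide : ∀ ε D → 0ℚ < ε → 0ℚ < D → ∃[ δ ] (0ℚ < δ × D * δ ≡ ε)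
  divide ε D 0<ε 0<D = 1/ D * ε , positive⁻¹ (1/ D * ε) {{pos*pos⇒pos (1/ D) {{1/pos⇒pos D}} ε}} , eq
    where
    instance
      D-pos : Positive D
      D-pos = positive 0<D

      D-nonZero : NonZero D
      D-nonZero = pos⇒nonZero D

      ε-pos : Positive ε
      ε-pos = positive 0<ε

    eq : D * (1/ D * ε) ≡ ε
    eq = trans (sym (*-assoc D (1/ D) ε))
        (trans (cong (_* ε) (*-inverseʳ D)) (*-identityˡ ε))

  product-within : ∀ s t B C δ ε → 0ℚ < B → 0ℚ < C → (B + C) * δ ≡ ε →
    EventuallyBounded s B → EventuallyBounded t C →
    EventuallyWithin s δ → EventuallyWithin t δ →
    EventuallyWithin (λ n → s n * t n) ε
  product-within s t B C δ ε 0<B 0<C [B+C]δ≡ε (M₁ , s≤B) (M₂ , t≤C) (N₁ , s-close) (N₂ , t-close) =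
    (M₁ ℕ.⊔ M₂) ℕ.⊔ (N₁ ℕ.⊔ N₂) , close
    where
    close : ∀ m n → (M₁ ℕ.⊔ M₂) ℕ.⊔ (N₁ ℕ.⊔ N₂) ℕ.≤ m → (M₁ ℕ.⊔ M₂) ℕ.⊔ (N₁ ℕ.⊔ N₂) ℕ.≤ n →
            ∣ s m * t m - s n * t n ∣ < ε
    close m n N≤m N≤n = subst (∣ s m * t m - s n * t n ∣ <_) [B+C]δ≡ε
      (product-close (s m) (t m) (s n) (t n) B C δ 0<B 0<C
        (s≤B m (ℕₚ.m⊔n≤o⇒m≤o M₁ M₂ M≤m)) (t≤C n (ℕₚ.m⊔n≤o⇒n≤o M₁ M₂ M≤n))
        (s-close m n (ℕₚ.m⊔n≤o⇒m≤o N₁ N₂ N≤m′) (ℕₚ.m⊔n≤o⇒m≤o N₁ N₂ N≤n′))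
        (t-close m n (ℕₚ.m⊔n≤o⇒n≤o N₁ N₂ N≤m′) (ℕₚ.m⊔n≤o⇒n≤o N₁ N₂ N≤n′)))
      where
      M≤m  = ℕₚ.m⊔n≤o⇒m≤o (M₁ ℕ.⊔ M₂) (N₁ ℕ.⊔ N₂) N≤m
      M≤n  = ℕₚ.m⊔n≤o⇒m≤o (M₁ ℕ.⊔ M₂) (N₁ ℕ.⊔ N₂) N≤n
      N≤m′ = ℕₚ.m⊔n≤o⇒n≤o (M₁ ℕ.⊔ M₂) (N₁ ℕ.⊔ N₂) N≤m
      N≤n′ = ℕₚ.m⊔n≤o⇒n≤o (M₁ ℕ.⊔ M₂) (N₁ ℕ.⊔ N₂) N≤n

  *-isCauchy : ∀ s t → IsCauchy s → IsCauchy t → IsCauchy (λ n → s n * t n)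
  *-isCauchy s t cs ct ε 0<ε =
    let B , 0<B , s≤B = eventually-bounded {s} cs
        C , 0<C , t≤C = eventually-bounded {t} ct
        δ , 0<δ , eq  = divide ε (B + C) 0<ε
          (positive⁻¹ (B + C) {{pos+pos⇒pos B {{positive 0<B}} C {{positive 0<C}}}})
    in product-within s t B C δ ε 0<B 0<C eq s≤B t≤C (cs δ 0<δ) (ct δ 0<δ)

infixl 7 _*ℝ_

_*ℝ_ : ℝ → ℝ → ℝ
a *ℝ b = mkℝ (λ n → seq a n * seq b n) (*-isCauchy (seq a) (seq b) (isCauchy a) (isCauchy b))

-- The floor is a relation because it is not a computable function on ℝ.
infix 4 ⌊_⌋≡_

⌊_⌋≡_ : ℝ → ℤ → Set
⌊ a ⌋≡ z = ℤ→ℝ z ≤ℝ a × a <ℝ ℤ→ℝ (z ℤ.+ + 1)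

difference-nonZero : ∀ {x y} → x ℤ.< y → NonZero (fromℤ (y ℤ.- x))
difference-nonZero {x} {y} x<y =
  ℤ.≢-nonZero λ y-x≡0 → ℤₚ.<-irrefl (sym (ℤₚ.i-j≡0⇒i≡j y x y-x≡0)) x<y

{-# OPTIONS --safe #-}

-- Let k i be a natural number with ⌊τ k i⌋ = x + i, for 0 ≤ i ≤ d = y − x.
-- Since τ ≥ 0, a larger floor needs a larger multiplier, so k is strictly
-- increasing and k d − k 0 ≥ d.  As τ k d < y + 1 and x ≤ τ k 0, this gives
-- τ d ≤ τ (k d − k 0) < d + 1.
module Submission where

open import Defs
open import Data.Integer as ℤ using (ℤ; +_)
import Data.Integer.Properties as ℤₚ
open import Data.Integer.Tactic.RingSolver using (solve-∀)
open import Data.Rational as ℚ using (ℚ; 0ℚ; 1ℚ; ½; _+_; _*_; -_; _≤_; _<_; 1/_)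
open import Data.Rational.Literals using (fromℤ)
open import Data.Rational.Properties
open import Data.Rational.Solver using (module +-*-Solver)
import Data.Rational.Unnormalised as ℚᵘ
import Data.Rational.Unnormalised.Properties as ℚᵘₚ
open import Data.Nat as ℕ using (ℕ; zero; suc; z≤n)
import Data.Nat.Properties as ℕₚ
open import Data.List using (List)
open import Data.List.Membership.Propositional using (_∈_)
open import Data.Product using (∃-syntax; _×_; _,_; proj₁; proj₂)
open import Relation.Binary.PropositionalEquality
  using (_≡_; refl; cong; subst)
open import Relation.Nullary using (¬_)

open +-*-Solver

-- Addition on `ℚ` normalises by a gcd, which does not reduce on variables. Between unnormalised
-- fractions only an integer identity over denominator 1 remains.
fromℤ-homo-+ : ∀ i j → fromℤ (i ℤ.+ j) ≡ fromℤ i + fromℤ j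
fromℤ-homo-+ i j = toℚᵘ-injective
  (ℚᵘₚ.≃-trans (ℚᵘ.*≡* (unit-denominators i j)) (ℚᵘₚ.≃-sym (toℚᵘ-homo-+ (fromℤ i) (fromℤ j))))
  where
  unit-denominators : ∀ i j → (i ℤ.+ j) ℤ.* + 1 ≡ (i ℤ.* + 1 ℤ.+ j ℤ.* + 1) ℤ.* + 1
  unit-denominators = solve-∀

fromℤ-mono-≤ : ∀ {i j} → i ℤ.≤ j → fromℤ i ≤ fromℤ j
fromℤ-mono-≤ i≤j = ℚ.*≤* (ℤₚ.*-monoʳ-≤-nonNeg (+ 1) i≤j)

fromℤ-mono-< : ∀ {i j} → i ℤ.< j → fromℤ i < fromℤ j
fromℤ-mono-< i<j = ℚ.*<* (ℤₚ.*-monoʳ-<-pos (+ 1) i<j)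

+-cancelˡ-≤ : ∀ r {p q} → r + p ≤ r + q → p ≤ q
+-cancelˡ-≤ r {p} {q} r+p≤r+q = begin
  p              ≡⟨ cancel r p ⟩
  - r + (r + p)  ≤⟨ +-monoʳ-≤ (- r) r+p≤r+q ⟩
  - r + (r + q)  ≡⟨ cancel r q ⟨
  q              ∎
  where
  open ≤-Reasoning
  cancel : ∀ r p → p ≡ - r + (r + p)
  cancel = solve 2 (λ r p → p := (:- r) :+ (r :+ p)) refl

p+ε≰p : ∀ p {ε} → 0ℚ < ε → ¬ p + ε ≤ p
p+ε≰p p {ε} 0<ε p+ε≤p = <-irrefl refl (begin-strict
  p       ≡⟨ +-identityʳ p ⟨
  p + 0ℚ  <⟨ +-monoʳ-< p 0<ε ⟩
  p + ε   ≤⟨ p+ε≤p ⟩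
  p       ∎)
  where open ≤-Reasoning

half-positive : ∀ ε → 0ℚ < ε → 0ℚ < ½ * ε
half-positive ε 0<ε = positive⁻¹ (½ * ε) {{pos*pos⇒pos ½ ε {{ℚ.positive 0<ε}}}}

-- The gap `ε` of a strict inequality pays for the error of a weak one: `_≤ℝ_` allows any positive
-- error, and choosing `½ * ε` leaves half of the gap.
half-slack : ∀ p q u w ε → p + ε ≤ w → u ≤ q + ½ * ε → u + p + ½ * ε ≤ w + q
half-slack p q u w ε p+ε≤w u≤q+½ε = begin
  u + p + ½ * ε              ≤⟨ +-monoˡ-≤ (½ * ε) (+-monoˡ-≤ p u≤q+½ε) ⟩
  (q + ½ * ε) + p + ½ * ε    ≡⟨ regroup p q ε ⟩
  (p + ε) + q                ≤⟨ +-monoˡ-≤ q p+ε≤w ⟩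
  w + q                      ∎
  where
  open ≤-Reasoning
  regroup : ∀ p q ε → (q + ½ * ε) + p + ½ * ε ≡ (p + ε) + q
  regroup = solve 3 (λ p q ε →
    (q :+ con ½ :* ε) :+ p :+ con ½ :* ε := (p :+ ε) :+ q) refl

*-fromℕ-mono-≤ : ∀ {s} → 0ℚ ≤ s → ∀ {a b} → a ℕ.≤ b → s * fromℤ (+ a) ≤ s * fromℤ (+ b)
*-fromℕ-mono-≤ {s} 0≤s a≤b =
  *-monoˡ-≤-nonNeg s {{ℚ.nonNegative 0≤s}} (fromℤ-mono-≤ (ℤ.+≤+ a≤b))

-- A weak inequality of reals bounds the terms only up to an error. The error 1 already gives the
-- sign, which is what monotonicity of multiplication by `seq τ n` needs.
eventually-nonNegative : ∀ τ → ℚ→ℝ 1ℚ ≤ℝ τ → ∃[ N ] (∀ n → N ℕ.≤ n → 0ℚ ≤ seq τ n)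
eventually-nonNegative τ 1≤τ with 1≤τ 1ℚ (positive⁻¹ 1ℚ)
... | N , 1≤s+1 = N , λ n N≤n → +-cancelˡ-≤ 1ℚ
  (≤-trans (1≤s+1 n N≤n) (≤-reflexive (+-comm (seq τ n) 1ℚ)))

module _ (τ : ℝ) (1≤τ : ℚ→ℝ 1ℚ ≤ℝ τ) where

  -- τ b − τ a < v + 1 − u, with both sides moved so that no subtraction occurs.
  floor-difference : ∀ {a b u v} → ⌊ τ *ℝ ℕ→ℝ a ⌋≡ u → ⌊ τ *ℝ ℕ→ℝ b ⌋≡ v →
    ∃[ ε ] (0ℚ < ε × ∃[ N ] (∀ n → N ℕ.≤ n → 0ℚ ≤ seq τ n ×
      fromℤ u + seq τ n * fromℤ (+ b) + ε ≤ fromℤ (v ℤ.+ + 1) + seq τ n * fromℤ (+ a)))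
  floor-difference {a} {b} {u} {v} (u≤τa , _) (_ , ε , 0<ε , N₁ , τb<v+1) =
    let N₂ , u≤τa+½ε = u≤τa (½ * ε) (half-positive ε 0<ε)
        N₃ , 0≤τ     = eventually-nonNegative τ 1≤τ
    in ½ * ε , half-positive ε 0<ε , N₁ ℕ.⊔ N₂ ℕ.⊔ N₃ , λ n N≤n →
      let s     = seq τ n
          N₁₂≤n = ℕₚ.m⊔n≤o⇒m≤o (N₁ ℕ.⊔ N₂) N₃ N≤n
      in 0≤τ n (ℕₚ.m⊔n≤o⇒n≤o (N₁ ℕ.⊔ N₂) N₃ N≤n) ,
        half-slack (s * fromℤ (+ b)) (s * fromℤ (+ a)) (fromℤ u) (fromℤ (v ℤ.+ + 1)) ε
          (τb<v+1 n (ℕₚ.m⊔n≤o⇒m≤o N₁ N₂ N₁₂≤n))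
          (u≤τa+½ε n (ℕₚ.m⊔n≤o⇒n≤o N₁ N₂ N₁₂≤n))

  -- If `b ≤ a`, then `τ b ≤ τ a < u + 1 ≤ v ≤ τ b`, which is absurd.
  floor-reflects-< : ∀ {a b u v} → ⌊ τ *ℝ ℕ→ℝ a ⌋≡ u → ⌊ τ *ℝ ℕ→ℝ b ⌋≡ v →
    u ℤ.< v → a ℕ.< b
  floor-reflects-< {a} {b} {u} {v} τa≈u τb≈v u<v = ℕₚ.≰⇒> λ b≤a →
    -- The two floors enter in swapped order, so that `v` bounds from below and `u + 1` from above.
    -- The single index `N` suffices, as the contradiction is between rationals.
    let ε , 0<ε , N , bound = floor-difference τb≈v τa≈u
        0≤s , le = bound N ℕₚ.≤-refl
        s = seq τ N
        open ≤-Reasoning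
    in p+ε≰p (fromℤ v + s * fromℤ (+ a)) 0<ε (begin
      fromℤ v + s * fromℤ (+ a) + ε           ≤⟨ le ⟩
      fromℤ (u ℤ.+ + 1) + s * fromℤ (+ b)     ≤⟨ +-mono-≤ (fromℤ-mono-≤ u+1≤v) (*-fromℕ-mono-≤ 0≤s b≤a) ⟩
      fromℤ v + s * fromℤ (+ a)               ∎)
    where
    u+1≤v : u ℤ.+ + 1 ℤ.≤ v
    u+1≤v = subst (ℤ._≤ v) (ℤₚ.+-comm (+ 1) u) (ℤₚ.i<j⇒suc[i]≤j u<v)

  module _ (x : ℤ) (d : ℕ)
           (hits : ∀ i → i ℕ.≤ d → ∃[ k ] ⌊ τ *ℝ ℕ→ℝ k ⌋≡ x ℤ.+ + i) where

    -- Each unit step of the floor raises the multiplier by at least one. The proof `i≤d` is named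
    -- because the multiplier chosen by `hits` may depend on it.
    multipliers-spread : ∀ i (i≤d : i ℕ.≤ d) → proj₁ (hits 0 z≤n) ℕ.+ i ℕ.≤ proj₁ (hits i i≤d)
    multipliers-spread zero    z≤n   = ℕₚ.≤-reflexive (ℕₚ.+-identityʳ _)
    multipliers-spread (suc i) i+1≤d = begin
      proj₁ (hits 0 z≤n) ℕ.+ suc i    ≡⟨ ℕₚ.+-suc _ i ⟩
      suc (proj₁ (hits 0 z≤n) ℕ.+ i)  ≤⟨ ℕ.s≤s (multipliers-spread i i≤d) ⟩
      suc (proj₁ (hits i i≤d))        ≤⟨ floor-reflects-< (proj₂ (hits i i≤d)) (proj₂ (hits (suc i) i+1≤d))
                                           (ℤₚ.+-monoʳ-< x (ℤ.+<+ (ℕₚ.n<1+n i))) ⟩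
      proj₁ (hits (suc i) i+1≤d)      ∎
      where
      open ℕₚ.≤-Reasoning
      i≤d = ℕₚ.<⇒≤ i+1≤d

    -- The multipliers of the two extreme floors are at least `d` apart, while their products with
    -- `τ` differ by less than `d + 1`.
    d*τ<d+1 : ∃[ ε ] (0ℚ < ε × ∃[ N ] (∀ n → N ℕ.≤ n →
      fromℤ (+ d) * seq τ n + ε ≤ fromℤ (+ d) + 1ℚ))
    d*τ<d+1 =
      let a , τa≈x = hits 0 z≤n
          b , τb≈y = hits d ℕₚ.≤-refl
          ε , 0<ε , N , bound = floor-difference τa≈x τb≈y
      in ε , 0<ε , N , λ n N≤n →
      let 0≤s , le = bound n N≤n
          -- The same proof `≤-refl` as in the choice of `b`, so the bound concerns this very
          -- multiplier.
          a+d≤b = multipliers-spread d ℕₚ.≤-refl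
          s = seq τ n
          X = fromℤ x ; A = fromℤ (+ a) ; B = fromℤ (+ b) ; D = fromℤ (+ d)
          open ≤-Reasoning
      in +-cancelˡ-≤ (X + s * A) (begin
        (X + s * A) + (D * s + ε)                ≡⟨ collect X s A D ε ⟩
        X + s * (A + D) + ε                      ≡⟨ cong (λ t → X + s * t + ε) (fromℤ-homo-+ (+ a) (+ d)) ⟨
        X + s * fromℤ (+ (a ℕ.+ d)) + ε          ≤⟨ +-monoˡ-≤ ε (+-monoʳ-≤ X (*-fromℕ-mono-≤ 0≤s a+d≤b)) ⟩
        X + s * B + ε                            ≡⟨ cong (λ z → fromℤ z + s * B + ε) (ℤₚ.+-identityʳ x) ⟨
        fromℤ (x ℤ.+ + 0) + s * B + ε            ≤⟨ le ⟩
        fromℤ (x ℤ.+ + d ℤ.+ + 1) + s * A        ≡⟨ cong (_+ s * A) (fromℤ-homo-+ (x ℤ.+ + d) (+ 1)) ⟩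
        fromℤ (x ℤ.+ + d) + 1ℚ + s * A           ≡⟨ cong (λ t → t + 1ℚ + s * A) (fromℤ-homo-+ x (+ d)) ⟩
        X + D + 1ℚ + s * A                       ≡⟨ rearrange X D (s * A) ⟩
        (X + s * A) + (D + 1ℚ)                   ∎)
      where
      collect : ∀ X s A D ε → (X + s * A) + (D * s + ε) ≡ X + s * (A + D) + ε
      collect = solve 5 (λ X s A D ε →
        (X :+ s :* A) :+ (D :* s :+ ε) := X :+ s :* (A :+ D) :+ ε) refl
      rearrange : ∀ X D t → X + D + 1ℚ + t ≡ (X + t) + (D + 1ℚ)
      rearrange = solve 3 (λ X D t →
        X :+ D :+ con 1ℚ :+ t := (X :+ t) :+ (D :+ con 1ℚ)) refl

-- Division by `q` shrinks the gap `ε` to `1/ q * ε`, which witnesses the strict inequality.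
<ℝ-divide : ∀ τ q .{{_ : ℚ.NonZero q}} → 0ℚ < q →
  ∃[ ε ] (0ℚ < ε × ∃[ N ] (∀ n → N ℕ.≤ n → q * seq τ n + ε ≤ q + 1ℚ)) →
  τ <ℝ ℚ→ℝ (1ℚ + 1/ q)
<ℝ-divide τ q {{nz}} 0<q (ε , 0<ε , N , bound) =
  1/ q * ε , positive⁻¹ (1/ q * ε) {{pos*pos⇒pos ((1/ q) {{nz}}) {{1/pos⇒pos q}} ε {{ℚ.positive 0<ε}}}} , N ,
  λ n N≤n → *-cancelˡ-≤-pos q (begin
    q * (seq τ n + 1/ q * ε)      ≡⟨ expand q (seq τ n) (1/ q) ε ⟩
    q * seq τ n + (q * 1/ q) * ε  ≡⟨ cong (λ t → q * seq τ n + t * ε) (*-inverseʳ q) ⟩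
    q * seq τ n + 1ℚ * ε          ≡⟨ cong (λ t → q * seq τ n + t) (*-identityˡ ε) ⟩
    q * seq τ n + ε               ≤⟨ bound n N≤n ⟩
    q + 1ℚ                        ≡⟨ cong (λ t → q + t) (*-inverseʳ q) ⟨
    q + q * 1/ q                  ≡⟨ cong (_+ q * 1/ q) (*-identityʳ q) ⟨
    q * 1ℚ + q * 1/ q             ≡⟨ *-distribˡ-+ q 1ℚ (1/ q) ⟨
    q * (1ℚ + 1/ q)               ∎)
  where
  open ≤-Reasoning
  instance
    q-pos : ℚ.Positive q
    q-pos = ℚ.positive 0<q
  expand : ∀ q s r ε → q * (s + r * ε) ≡ q * s + (q * r) * ε
  expand = solve 4 (λ q s r ε → q :* (s :+ r :* ε) := q :* s :+ (q :* r) :* ε) refl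

proposition8 : (τ : ℝ) → ℚ→ℝ 1ℚ ≤ℝ τ →
    (S : List ℤ) → (∀ s → s ∈ S → ∃[ k ] ⌊ τ *ℝ ℕ→ℝ k ⌋≡ s) →
    (x y : ℤ) → (x<y : x ℤ.< y) →
    (∀ z → x ℤ.≤ z → z ℤ.≤ y → z ∈ S) →
    τ <ℝ ℚ→ℝ (1ℚ ℚ.+ (1/ fromℤ (y ℤ.- x)) {{difference-nonZero x<y}})
proposition8 τ 1≤τ S floors x y x<y interval⊆S =
  <ℝ-divide τ (fromℤ (y ℤ.- x)) {{difference-nonZero x<y}}
    (fromℤ-mono-< (subst (ℤ._< y ℤ.- x) (ℤₚ.+-inverseʳ x) (ℤₚ.+-monoˡ-< (ℤ.- x) x<y)))
    (subst (λ z → ∃[ ε ] (0ℚ < ε × ∃[ N ] (∀ n → N ℕ.≤ n → fromℤ z * seq τ n + ε ≤ fromℤ z + 1ℚ)))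
      +d≡y-x (d*τ<d+1 τ 1≤τ x d hits))
  where
  -- The length is taken as a natural number, so that the multipliers can be compared by induction;
  -- `+d≡y-x` leads back to the integer difference.
  d : ℕ
  d = ℤ.∣ y ℤ.- x ∣

  +d≡y-x : + d ≡ y ℤ.- x
  +d≡y-x = ℤₚ.0≤i⇒+∣i∣≡i (ℤₚ.i≤j⇒0≤j-i (ℤₚ.<⇒≤ x<y))

  x+[y-x]≡y : ∀ x y → x ℤ.+ (y ℤ.- x) ≡ y
  x+[y-x]≡y = solve-∀

  hits : ∀ i → i ℕ.≤ d → ∃[ k ] ⌊ τ *ℝ ℕ→ℝ k ⌋≡ x ℤ.+ + i
  hits i i≤d = floors (x ℤ.+ + i) (interval⊆S (x ℤ.+ + i) (ℤₚ.i≤i+j x (+ i)) (begin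
    x ℤ.+ + i          ≤⟨ ℤₚ.+-monoʳ-≤ x (ℤ.+≤+ i≤d) ⟩
    x ℤ.+ + d          ≡⟨ cong (λ z → x ℤ.+ z) +d≡y-x ⟩
    x ℤ.+ (y ℤ.- x)    ≡⟨ x+[y-x]≡y x y ⟩
    y                  ∎))
    where open ℤₚ.≤-Reasoning
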